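{- The system with axioms L1 $=i(i(x,y),i(i(y,z),i(x,z)))$, L2 $=i(i(n(x),x),x)$, L3 $=i(x,i(n(x),y))$ and condensed detachment as sole rule of inference admits strong double-negation elimination.
   Context: Formulas are terms built from propositional variables using the binary connective $i$ (implication) and the unary connective $n$ (negation). Condensed detachment: from a major premiss $i(A,B)$ and a minor premiss $C$, after renaming variables so that the two premisses share no variables, if $A$ and $C$ are unifiable with most general unifier $\sigma$, infer $B\sigma$. Alphabetic variants of axioms count as axioms, and conclusions may be renamed. A proof is a finite sequence of formulas each an axiom or obtained from earlier lines by the rule; deduced steps are the non-axiom lines. Given a formula $B$, a formula $B^*$ is obtained from $B$ by selecting some set of doubly negated subformulas $n(n(q))$ of $B$ and replacing all occurrences of each selected subformula by $q$. A system admits strong double-negation elimination if whenever it proves $B$ and $B^*$ is obtained from $B$ in this way, there is a proof of $B^*$ in the system in which every subformula of the form $n(n(t))$ of a deduced step occurs (up to renaming of variables) as a subformula of $B^*$. -}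

module Defs where

open import Data.List.Base using (List; []; _∷_)
open import Data.List.Membership.Propositional using (_∈_; _∉_)
open import Data.List.Relation.Unary.All using (All)
open import Data.List.Relation.Unary.Any using (Any)
open import Data.Nat.Base using (ℕ)
open import Data.Product.Base using (∃-syntax; _×_)
open import Function.Base using (_∘_)
open import Function.Definitions using (Injective)
open import Relation.Binary.PropositionalEquality.Core using (_≡_)
open import Relation.Nullary.Negation.Core using (¬_)

data Formula : Set where
  var : ℕ → Formula
  i   : Formula → Formula → Formula
  n   : Formula → Formula

infix 4 _⊑_ _~_

data _⊑_ (A : Formula) : Formula → Set where
  here   : A ⊑ A
  left   : ∀ {B C} → A ⊑ B → A ⊑ i B C
  right  : ∀ {B C} → A ⊑ C → A ⊑ i B C
  negand : ∀ {B} → A ⊑ B → A ⊑ n B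

Subst : Set
Subst = ℕ → Formula

infixl 8 _[_]

_[_] : Formula → Subst → Formula
var x [ σ ] = σ x
i A B [ σ ] = i (A [ σ ]) (B [ σ ])
n A   [ σ ] = n (A [ σ ])

-- Alphabetic variants.  A renaming injective on the finitely many variables
-- of A extends to an injection of ℕ, so total injections lose nothing.
_~_ : Formula → Formula → Set
A ~ B = ∃[ ρ ] Injective _≡_ _≡_ ρ × A [ var ∘ ρ ] ≡ B

ShareNoVariables : Formula → Formula → Set
ShareNoVariables A C = ∀ x → var x ⊑ A → ¬ (var x ⊑ C)

Unifies : Subst → Formula → Formula → Set
Unifies σ A C = A [ σ ] ≡ C [ σ ]

-- The factorisation is required at every variable, not just those of A and C;
-- hence B [ σ ] is unique up to renaming even if B has further variables.
record IsMGU (σ : Subst) (A C : Formula) : Set where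
  field
    unifies     : Unifies σ A C
    mostGeneral : ∀ τ → Unifies τ A C → ∃[ δ ] (∀ x → τ x ≡ σ x [ δ ])

record CondensedDetachment (major minor conclusion : Formula) : Set where
  field
    A B C        : Formula
    majorVariant : major ~ i A B
    minorVariant : minor ~ C
    apart        : ShareNoVariables (i A B) C
    σ            : Subst
    mgu          : IsMGU σ A C
    result       : B [ σ ] ~ conclusion

-- A system is given by its list of axioms.
System : Set
System = List Formula

IsAxiom : System → Formula → Set
IsAxiom L A = Any (_~ A) L

-- Proofs are listed with the last line first.
data IsProof (L : System) : List Formula → Set where
  empty  : IsProof L []
  axiom  : ∀ {Γ A} → IsProof L Γ → IsAxiom L A → IsProof L (A ∷ Γ)
  detach : ∀ {Γ M N D} → IsProof L Γ → M ∈ Γ → N ∈ Γ →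
           CondensedDetachment M N D → IsProof L (D ∷ Γ)

Proves : System → Formula → Set
Proves L B = ∃[ Γ ] IsProof L (B ∷ Γ)

DeducedStep : System → List Formula → Formula → Set
DeducedStep L Γ D = D ∈ Γ × ¬ IsAxiom L D

-- Simultaneous replacement of all occurrences of the formulas n (n q) in S.
-- Replacement continues inside q; where selected occurrences overlap, as in
-- n (n (n q)), the outermost one is erased first.
data Erase (S : List Formula) : Formula → Formula → Set where
  var  : ∀ {x} → Erase S (var x) (var x)
  i    : ∀ {A A′ B B′} → Erase S A A′ → Erase S B B′ → Erase S (i A B) (i A′ B′)
  keep : ∀ {A A′} → n A ∉ S → Erase S A A′ → Erase S (n A) (n A′)
  drop : ∀ {q q′} → n (n q) ∈ S → Erase S q q′ → Erase S (n (n q)) q′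

DoublyNegatedSubformula : Formula → Formula → Set
DoublyNegatedSubformula B A = A ⊑ B × ∃[ q ] A ≡ n (n q)

_IsDoubleNegationReductOf_ : Formula → Formula → Set
B* IsDoubleNegationReductOf B =
  ∃[ S ] All (DoublyNegatedSubformula B) S × Erase S B B*

AdmitsStrongDoubleNegationElimination : System → Set
AdmitsStrongDoubleNegationElimination L =
  ∀ B B* → Proves L B → B* IsDoubleNegationReductOf B →
  ∃[ Γ ] IsProof L (B* ∷ Γ) ×
    (∀ D t → DeducedStep L (B* ∷ Γ) D → n (n t) ⊑ D →
     ∃[ s ] s ⊑ B* × s ~ n (n t))

L1 L2 L3 : Formula
L1 = i (i x y) (i (i y z) (i x z))
  where x = var 0 ; y = var 1 ; z = var 2
L2 = i (i (n x) x) x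
  where x = var 0
L3 = i x (i (n x) y)
  where x = var 0 ; y = var 1

Łukasiewicz : System
Łukasiewicz = L1 ∷ L2 ∷ L3 ∷ []

{-# OPTIONS --safe #-}
module Submission where

-- Apply to every substitution instance of every line of a proof of B a map that
-- performs the given erasure and then removes each double negation that does
-- not occur in B*.  The map commutes with i and satisfies, for every A, either
-- f (n A) = n (f A) or f A = n (f (n A)); so modus ponens is preserved, and
-- instances of the axioms become instances of L1, L2, L3, i (i x (n x)) (n x) or
-- i (n x) (i x y).  The last two have condensed-detachment proofs without double
-- negations.  It remains to prove substitution instances of theorems by condensed
-- detachment.  Detaching C from i F F, where F is an instance of C, yields F, and
-- i F F is built up along F without other double negations than those of F.

open import Defs
open import Data.Bool.Base using (true; false; if_then_else_)
open import Data.Empty using (⊥)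
open import Data.List.Base using (List; []; _∷_; _++_; deduplicate)
open import Data.List.Membership.Propositional.Properties using (∈-++⁺ˡ; ∈-++⁺ʳ)
open import Data.List.Relation.Unary.All using (All; []; _∷_; lookup)
open import Data.List.Relation.Unary.All.Properties using (++⁺)
open import Data.List.Relation.Unary.Any using (here; there; any?)
open import Data.Maybe.Base using (Maybe; just; nothing)
open import Data.Nat.Base using (ℕ; zero; suc; _+_; _⊔_; _<_; z≤n; s≤s)
open import Data.Nat.Properties using (_≟_; +-comm; +-suc; ≤-refl; ≤-trans; +-monoˡ-<; m≤m⊔n; m≤n⊔m; m<n⇒m<1+n; m<1+n⇒m<n∨m≡n; m≤n⇒m≤o+n; allUpTo?)
open import Data.Product.Base using (∃-syntax; _×_; _,_; proj₁; proj₂)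
open import Data.Sum.Base using (_⊎_; inj₁; inj₂)
open import Data.Unit.Base using (⊤; tt)
open import Function.Base using (_∘_; const; id)
open import Relation.Binary.PropositionalEquality using (_≡_; refl; sym; trans; cong; cong₂; subst; module ≡-Reasoning)
open import Relation.Nullary.Decidable using (Dec; does; yes; no; True; toWitness; map′; _×-dec_; _⊎-dec_)
open import Relation.Nullary.Negation.Core using (¬_; contradiction)

private
  variable
    A B C M N T : Formula
    σ τ : Subst

-- Decidable equality and subformulas.

i-injective : ∀ {A B C D : Formula} → Formula.i A B ≡ i C D → A ≡ C × B ≡ D
i-injective refl = refl , refl

n-injective : Formula.n A ≡ n B → A ≡ B
n-injective refl = refl

infix 4 _≟ᶠ_ _⊑?_

_≟ᶠ_ : (A B : Formula) → Dec (A ≡ B)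
var x ≟ᶠ var y = map′ (cong var) (λ { refl → refl }) (x ≟ y)
i A B ≟ᶠ i C D = map′ (λ (p , q) → cong₂ i p q) i-injective ((A ≟ᶠ C) ×-dec (B ≟ᶠ D))
n A ≟ᶠ n B = map′ (cong n) n-injective (A ≟ᶠ B)
var _ ≟ᶠ i _ _ = no λ ()
var _ ≟ᶠ n _ = no λ ()
i _ _ ≟ᶠ var _ = no λ ()
i _ _ ≟ᶠ n _ = no λ ()
n _ ≟ᶠ var _ = no λ ()
n _ ≟ᶠ i _ _ = no λ ()

_⊑?_ : (A B : Formula) → Dec (A ⊑ B)
A ⊑? B with A ≟ᶠ B
... | yes refl = yes here
A ⊑? var x | no A≢B = no λ { here → A≢B refl }
A ⊑? i B C | no A≢B = map′ (λ { (inj₁ p) → left p ; (inj₂ p) → right p })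
  (λ { here → contradiction refl A≢B ; (left p) → inj₁ p ; (right p) → inj₂ p }) ((A ⊑? B) ⊎-dec (A ⊑? C))
A ⊑? n B | no A≢B = map′ negand (λ { here → contradiction refl A≢B ; (negand p) → p }) (A ⊑? B)

⊑-trans : A ⊑ B → B ⊑ C → A ⊑ C
⊑-trans p here = p
⊑-trans p (left q) = left (⊑-trans p q)
⊑-trans p (right q) = right (⊑-trans p q)
⊑-trans p (negand q) = negand (⊑-trans p q)

-- Substitutions

infixl 8 _⨟_

_⨟_ : Subst → Subst → Subst
(σ ⨟ τ) x = σ x [ τ ]

[]-⨟ : ∀ A → A [ σ ] [ τ ] ≡ A [ σ ⨟ τ ]
[]-⨟ (var x) = refl
[]-⨟ (i A B) = cong₂ i ([]-⨟ A) ([]-⨟ B)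
[]-⨟ (n A) = cong n ([]-⨟ A)

AgreeOn : Formula → Subst → Subst → Set
AgreeOn A σ τ = ∀ {x} → var x ⊑ A → σ x ≡ τ x

[]-cong : ∀ A → AgreeOn A σ τ → A [ σ ] ≡ A [ τ ]
[]-cong (var x) h = h here
[]-cong (i A B) h = cong₂ i ([]-cong A (h ∘ left)) ([]-cong B (h ∘ right))
[]-cong (n A) h = cong n ([]-cong A (h ∘ negand))

[]-cong⁻¹ : ∀ A → A [ σ ] ≡ A [ τ ] → AgreeOn A σ τ
[]-cong⁻¹ A eq here = eq
[]-cong⁻¹ (i A B) eq (left p) = []-cong⁻¹ A (proj₁ (i-injective eq)) p
[]-cong⁻¹ (i A B) eq (right p) = []-cong⁻¹ B (proj₂ (i-injective eq)) p
[]-cong⁻¹ (n A) eq (negand p) = []-cong⁻¹ A (n-injective eq) p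

[]-var : ∀ A → A [ var ] ≡ A
[]-var (var x) = refl
[]-var (i A B) = cong₂ i ([]-var A) ([]-var B)
[]-var (n A) = cong n ([]-var A)

[]-fix : ∀ A → AgreeOn A σ var → A [ σ ] ≡ A
[]-fix A h = trans ([]-cong A h) ([]-var A)

⊑-[] : A ⊑ B → A [ σ ] ⊑ B [ σ ]
⊑-[] here = here
⊑-[] (left p) = left (⊑-[] p)
⊑-[] (right p) = right (⊑-[] p)
⊑-[] (negand p) = negand (⊑-[] p)

~-refl : A ~ A
~-refl {A} = id , id , []-var A

-- Bounds on variables and gluing of substitutions.

VarsBelow : ℕ → Formula → Set
VarsBelow k A = ∀ {x} → var x ⊑ A → x < k

bound : Formula → ℕ
bound (var x) = suc x
bound (i A B) = bound A ⊔ bound B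
bound (n A) = bound A

vars-below-bound : ∀ A → VarsBelow (bound A) A
vars-below-bound (var x) here = ≤-refl
vars-below-bound (i A B) (left p) = ≤-trans (vars-below-bound A p) (m≤m⊔n _ _)
vars-below-bound (i A B) (right p) = ≤-trans (vars-below-bound B p) (m≤n⊔m _ _)
vars-below-bound (n A) (negand p) = vars-below-bound A p

module _ {a} {X : Set a} where

  splice : ℕ → (ℕ → X) → (ℕ → X) → ℕ → X
  splice zero f g x = g x
  splice (suc k) f g zero = f zero
  splice (suc k) f g (suc x) = splice k (f ∘ suc) g x

  splice-below : ∀ {k f g x} → x < k → splice k f g x ≡ f x
  splice-below {suc k} {x = zero} _ = refl
  splice-below {suc k} {x = suc x} (s≤s x<k) = splice-below {k} x<k

  splice-from : ∀ k {f g} y → splice k f g (y + k) ≡ g y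
  splice-from k y rewrite +-comm y k = go k
    where
    go : ∀ k {f g} → splice k f g (k + y) ≡ g y
    go zero = refl
    go (suc k) = go k

  interleave : (ℕ → X) → (ℕ → X) → ℕ → X
  interleave f g zero = f zero
  interleave f g (suc zero) = g zero
  interleave f g (suc (suc x)) = interleave (f ∘ suc) (g ∘ suc) x

below-or-from : ∀ k x → x < k ⊎ ∃[ y ] y + k ≡ x
below-or-from zero x = inj₂ (x , +-comm x 0)
below-or-from (suc k) zero = inj₁ (s≤s z≤n)
below-or-from (suc k) (suc x) with below-or-from k x
... | inj₁ x<k = inj₁ (s≤s x<k)
... | inj₂ (y , refl) = inj₂ (y , +-suc y k)

-- Total injections with disjoint ranges that exhaust ℕ: they rename the two premisses apart, and
-- `interleave` glues substitutions for them.
even odd : ℕ → ℕ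
even zero = 0
even (suc x) = suc (suc (even x))
odd x = suc (even x)

module _ {a} {X : Set a} where

  interleave-even : ∀ (f g : ℕ → X) x → interleave f g (even x) ≡ f x
  interleave-even f g zero = refl
  interleave-even f g (suc x) = interleave-even (f ∘ suc) (g ∘ suc) x

  interleave-odd : ∀ (f g : ℕ → X) x → interleave f g (odd x) ≡ g x
  interleave-odd f g zero = refl
  interleave-odd f g (suc x) = interleave-odd (f ∘ suc) (g ∘ suc) x

even-or-odd : (P : ℕ → Set) → (∀ x → P (even x)) → (∀ x → P (odd x)) → ∀ z → P z
even-or-odd P e o zero = e 0
even-or-odd P e o (suc zero) = o 0
even-or-odd P e o (suc (suc z)) = even-or-odd (P ∘ suc ∘ suc) (e ∘ suc) (o ∘ suc) z

even-injective : ∀ {x y} → even x ≡ even y → x ≡ y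
even-injective {x} {y} eq = trans (sym (interleave-even id id x)) (trans (cong (interleave id id) eq) (interleave-even id id y))

odd-injective : ∀ {x y} → odd x ≡ odd y → x ≡ y
odd-injective {x} {y} eq = trans (sym (interleave-odd id id x)) (trans (cong (interleave id id) eq) (interleave-odd id id y))

-- `interleave (const true) (const false)` is the parity test.
even≢odd : ∀ {x y} → ¬ even x ≡ odd y
even≢odd {x} {y} eq with trans (sym (interleave-even (const true) (const false) x)) (trans (cong (interleave (const true) (const false)) eq) (interleave-odd (const true) (const false) y))
... | ()

evens odds : Subst
evens x = var (even x)
odds x = var (odd x)

var-⊑-rename : ∀ A {ρ : ℕ → ℕ} {z} → var z ⊑ A [ var ∘ ρ ] → ∃[ x ] ρ x ≡ z
var-⊑-rename (var x) here = x , refl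
var-⊑-rename (i A B) (left p) = var-⊑-rename A p
var-⊑-rename (i A B) (right p) = var-⊑-rename B p
var-⊑-rename (n A) (negand p) = var-⊑-rename A p

evens-odds-apart : ∀ A C → ShareNoVariables (A [ evens ]) (C [ odds ])
evens-odds-apart A C z p q with var-⊑-rename A p | var-⊑-rename C q
... | x , refl | y , eq = even≢odd (sym eq)

-- Derivations

-- Occurrence in `T` is literal, so no renaming has to be tracked through a derivation.
Allowed : Formula → Formula → Set
Allowed T D = ∀ {t} → n (n t) ⊑ D → n (n t) ⊑ T

allowed-var : ∀ {x} → Allowed T (var x)
allowed-var ()

allowed-i : Allowed T A → Allowed T B → Allowed T (i A B)
allowed-i a b (left p) = a p
allowed-i a b (right p) = b p

infix 3 _⊢_

data _⊢_ (T : Formula) : Formula → Set where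
  axiom  : IsAxiom Łukasiewicz A → T ⊢ A
  detach : T ⊢ M → T ⊢ N → CondensedDetachment M N A → Allowed T A → T ⊢ A

proof-++ : ∀ {L Γ Δ} → IsProof L Γ → IsProof L Δ → IsProof L (Γ ++ Δ)
proof-++ empty q = q
proof-++ (axiom p a) q = axiom (proof-++ p q) a
proof-++ (detach p M∈ N∈ cd) q = detach (proof-++ p q) (∈-++⁺ˡ M∈) (∈-++⁺ˡ N∈) cd

linearise : T ⊢ A → ∃[ Γ ] IsProof Łukasiewicz (A ∷ Γ) × All (λ D → IsAxiom Łukasiewicz D ⊎ Allowed T D) (A ∷ Γ)
linearise (axiom a) = [] , axiom empty a , inj₁ a ∷ []
linearise (detach p q cd ok) with linearise p | linearise q
... | Γ , pΓ , aΓ | Δ , pΔ , aΔ =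
  (_ ∷ Γ) ++ (_ ∷ Δ) , detach (proof-++ pΓ pΔ) (here refl) (∈-++⁺ʳ (_ ∷ Γ) (here refl)) cd , inj₂ ok ∷ ++⁺ aΓ aΔ

-- Only the variables that occur are constrained here; all others are sent to
-- variables beyond k, which makes the unifier most general on all of ℕ.
condense : ∀ σ₁ σ₂ → T ⊢ i A B → T ⊢ C → A [ σ₁ ] ≡ C [ σ₂ ] →
  (∀ τ₁ τ₂ → A [ τ₁ ] ≡ C [ τ₂ ] → ∃[ δ ] AgreeOn (i A B) τ₁ (σ₁ ⨟ δ) × AgreeOn C τ₂ (σ₂ ⨟ δ)) →
  Allowed T (B [ σ₁ ]) → T ⊢ B [ σ₁ ]
condense {T} {A} {B} {C} σ₁ σ₂ ⊢AB ⊢C unifies general =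
  detach ⊢AB ⊢C record
    { majorVariant = even , even-injective , refl
    ; minorVariant = odd , odd-injective , refl
    ; apart = evens-odds-apart (i A B) C
    ; σ = mgu
    ; mgu = record { unifies = mgu-unifies ; mostGeneral = mgu-general }
    ; result = subst (_~ _) (sym (agree₁ B right)) ~-refl
    }
  where
  k = bound (i (i A B [ σ₁ ]) (C [ σ₂ ]))

  restrict : Formula → Subst → (ℕ → ℕ) → Subst
  restrict D σ ρ x with var x ⊑? D
  ... | yes _ = σ x
  ... | no _ = var (ρ x + k)

  restrict-agree : ∀ D σ ρ → AgreeOn D (restrict D σ ρ) σ
  restrict-agree D σ ρ {x} p with var x ⊑? D
  ... | yes _ = refl
  ... | no ¬p = contradiction p ¬p

  mgu : Subst
  mgu = interleave (restrict (i A B) σ₁ even) (restrict C σ₂ odd)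

  agree₁ : ∀ D → (∀ {x} → var x ⊑ D → var x ⊑ i A B) → D [ evens ] [ mgu ] ≡ D [ σ₁ ]
  agree₁ D sub = trans ([]-⨟ D) ([]-cong D λ {x} p → trans (interleave-even _ _ x) (restrict-agree (i A B) σ₁ even (sub p)))

  agree₂ : C [ odds ] [ mgu ] ≡ C [ σ₂ ]
  agree₂ = trans ([]-⨟ C) ([]-cong C λ {x} p → trans (interleave-odd _ _ x) (restrict-agree C σ₂ odd p))

  mgu-unifies : Unifies mgu (A [ evens ]) (C [ odds ])
  mgu-unifies = trans (agree₁ A left) (trans unifies (sym agree₂))

  mgu-general : ∀ τ → Unifies τ (A [ evens ]) (C [ odds ]) → ∃[ δ ] (∀ x → τ x ≡ mgu x [ δ ])
  mgu-general τ eq with general (τ ∘ even) (τ ∘ odd) (trans (sym ([]-⨟ A)) (trans eq ([]-⨟ C)))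
  ... | δ , agrees₁ , agrees₂ = δ′ , even-or-odd _ on-even on-odd
    where
    δ′ = splice k δ τ

    factor : ∀ D σ ρ x → VarsBelow k (D [ σ ]) → AgreeOn D (τ ∘ ρ) (σ ⨟ δ) → τ (ρ x) ≡ restrict D σ ρ x [ δ′ ]
    factor D σ ρ x below agrees with var x ⊑? D
    -- If `x` occurs, `σ x` has only variables below `k`, where `δ′` is `δ`. Any other `x` was sent
    -- to `ρ x + k`, at which `δ′` gives back `τ (ρ x)`.
    ... | yes p = trans (agrees p) ([]-cong (σ x) λ q → sym (splice-below (below (⊑-trans q (⊑-[] p)))))
    ... | no _ = sym (splice-from k (ρ x))

    on-even : ∀ x → τ (even x) ≡ mgu (even x) [ δ′ ]
    on-even x = trans
      (factor (i A B) σ₁ even x (vars-below-bound (i (i A B [ σ₁ ]) (C [ σ₂ ])) ∘ left) agrees₁)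
      (cong (_[ δ′ ]) (sym (interleave-even _ _ x)))

    on-odd : ∀ x → τ (odd x) ≡ mgu (odd x) [ δ′ ]
    on-odd x = trans
      (factor C σ₂ odd x (vars-below-bound (i (i A B [ σ₁ ]) (C [ σ₂ ])) ∘ right) agrees₂)
      (cong (_[ δ′ ]) (sym (interleave-odd _ _ x)))

-- Only the minor premiss is instantiated, so a unifying pair `τ₁`, `τ₂` factors through `τ₁`
-- itself.
match-minor : ∀ τ → T ⊢ i (C [ τ ]) B → T ⊢ C → Allowed T B → T ⊢ B
match-minor {T} {C} {B} τ ⊢AB ⊢C ok =
  subst (T ⊢_) ([]-var B)
    (condense var τ ⊢AB ⊢C ([]-var (C [ τ ]))
      (λ τ₁ τ₂ eq → τ₁ , (λ _ → refl) , λ p → []-cong⁻¹ C (trans (sym eq) ([]-⨟ C)) p)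
      (subst (Allowed T) (sym ([]-var B)) ok))

modus-ponens : T ⊢ i A B → T ⊢ A → Allowed T B → T ⊢ B
modus-ponens {T} {A} ⊢AB = match-minor var (subst (λ A → T ⊢ i A _) (sym ([]-var A)) ⊢AB)

-- Here the minor premiss is left alone. Variables of the major from `m` on can occur only in `B`;
-- they are sent beyond the variables of the minor and so stay independent of them.
match-major : ∀ m k ς → T ⊢ i A B → (∀ {x} → x < m → var x ⊑ A) →
  let θ = splice m ς (λ y → var (y + k)) in
  T ⊢ A [ θ ] → VarsBelow k (A [ θ ]) → Allowed T (B [ θ ]) → T ⊢ B [ θ ]
match-major {T} {A} {B} m k ς ⊢AB occurs ⊢C below =
  condense θ var ⊢AB ⊢C (sym ([]-var (A [ θ ]))) general
  where
  θ = splice m ς (λ y → var (y + k))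

  general : ∀ τ₁ τ₂ → A [ τ₁ ] ≡ A [ θ ] [ τ₂ ] → ∃[ δ ] AgreeOn (i A B) τ₁ (θ ⨟ δ) × AgreeOn (A [ θ ]) τ₂ δ
  general τ₁ τ₂ eq = δ , (λ {x} _ → on-major x) , λ p → sym (splice-below (below p))
    where
    δ = splice k τ₂ (λ y → τ₁ (y + m))

    on-major : ∀ x → τ₁ x ≡ θ x [ δ ]
    on-major x with below-or-from m x
    ... | inj₁ x<m = trans ([]-cong⁻¹ A (trans eq ([]-⨟ A)) (occurs x<m))
                       ([]-cong (θ x) λ q → sym (splice-below (below (⊑-trans q (⊑-[] (occurs x<m))))))
    ... | inj₂ (y , refl) = sym (trans (cong (_[ δ ]) (splice-from m y)) (splice-from k y))

-- Evaluation of condensed-detachment terms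

infix 9 _↦_

_↦_ : ℕ → Formula → Subst
(x ↦ t) y with x ≟ y
... | yes _ = t
... | no _ = var y

↦-absorb : ∀ x t → τ x ≡ t [ τ ] → ∀ y → τ y ≡ (x ↦ t ⨟ τ) y
↦-absorb x t eq y with x ≟ y
... | yes refl = eq
... | no _ = refl

Equations : Set
Equations = List (Formula × Formula)

_[_]ᴱ : Equations → Subst → Equations
[] [ σ ]ᴱ = []
((A , C) ∷ E) [ σ ]ᴱ = (A [ σ ] , C [ σ ]) ∷ E [ σ ]ᴱ

Solves : Subst → Equations → Set
Solves τ = All λ (A , C) → Unifies τ A C

-- On clash, circularity or exhausted fuel the result is no unifier, but every
-- solution factors through it all the same.
unifier : ℕ → Equations → Subst
unifier zero E = var
unifier (suc k) [] = var
unifier (suc k) ((var x , t) ∷ E) = x ↦ t ⨟ unifier k (E [ x ↦ t ]ᴱ)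
unifier (suc k) ((t , var x) ∷ E) = x ↦ t ⨟ unifier k (E [ x ↦ t ]ᴱ)
unifier (suc k) ((i A B , i C D) ∷ E) = unifier k ((A , C) ∷ (B , D) ∷ E)
unifier (suc k) ((n A , n B) ∷ E) = unifier k ((A , B) ∷ E)
unifier (suc k) ((i _ _ , n _) ∷ E) = var
unifier (suc k) ((n _ , i _ _) ∷ E) = var

Solves-absorb : ∀ {E} → (∀ x → τ x ≡ (σ ⨟ τ) x) → Solves τ E → Solves τ (E [ σ ]ᴱ)
Solves-absorb h [] = []
Solves-absorb {E = (A , C) ∷ E} h (eq ∷ s) = trans (absorb A) (trans eq (sym (absorb C))) ∷ Solves-absorb h s
  where
  absorb : ∀ A → A [ _ ] [ _ ] ≡ A [ _ ]
  absorb A = trans ([]-⨟ A) ([]-cong A λ {x} _ → sym (h x))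

-- The factor is `τ` itself: a solution equates `x` and `t` already, so it absorbs the binding
-- `x ↦ t` and still solves the remaining equations.
unifier-general : ∀ k E → Solves τ E → ∀ x → τ x ≡ (unifier k E ⨟ τ) x
unifier-general {τ} k E s = go k E s
  where
  go : ∀ k E → Solves τ E → ∀ x → τ x ≡ (unifier k E ⨟ τ) x

  bind : ∀ k E x t → τ x ≡ t [ τ ] → Solves τ E → ∀ y → τ y ≡ ((x ↦ t ⨟ unifier k (E [ x ↦ t ]ᴱ)) ⨟ τ) y
  bind k E x t eq s y = begin
    τ y ≡⟨ ↦-absorb x t eq y ⟩
    (x ↦ t) y [ τ ] ≡⟨ []-cong ((x ↦ t) y) (λ {z} _ → go k _ (Solves-absorb (↦-absorb x t eq) s) z) ⟩
    (x ↦ t) y [ unifier k (E [ x ↦ t ]ᴱ) ⨟ τ ] ≡⟨ []-⨟ ((x ↦ t) y) ⟨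
    (x ↦ t) y [ unifier k (E [ x ↦ t ]ᴱ) ] [ τ ] ∎
    where open ≡-Reasoning

  go zero E s x = refl
  go (suc k) [] s x = refl
  go (suc k) ((var x , t) ∷ E) (eq ∷ s) = bind k E x t eq s
  go (suc k) ((i A B , var x) ∷ E) (eq ∷ s) = bind k E x (i A B) (sym eq) s
  go (suc k) ((n A , var x) ∷ E) (eq ∷ s) = bind k E x (n A) (sym eq) s
  go (suc k) ((i A B , i C D) ∷ E) (eq ∷ s) = go k _ (proj₁ (i-injective eq) ∷ proj₂ (i-injective eq) ∷ s)
  go (suc k) ((n A , n B) ∷ E) (eq ∷ s) = go k _ (n-injective eq ∷ s)
  go (suc k) ((i _ _ , n _) ∷ E) s x = refl
  go (suc k) ((n _ , i _ _) ∷ E) s x = refl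

NoDoubleNegation : Formula → Set
NoDoubleNegation (var x) = ⊤
NoDoubleNegation (i A B) = NoDoubleNegation A × NoDoubleNegation B
NoDoubleNegation (n (n A)) = ⊥
NoDoubleNegation (n A) = NoDoubleNegation A

noDoubleNegation? : ∀ A → Dec (NoDoubleNegation A)
noDoubleNegation? (var x) = yes tt
noDoubleNegation? (i A B) = noDoubleNegation? A ×-dec noDoubleNegation? B
noDoubleNegation? (n (n A)) = no λ ()
noDoubleNegation? (n (var x)) = yes tt
noDoubleNegation? (n (i A B)) = noDoubleNegation? (i A B)

allowed-noDoubleNegation : ∀ A → NoDoubleNegation A → Allowed T A
allowed-noDoubleNegation (i A B) (a , b) (left p) = allowed-noDoubleNegation A a p
allowed-noDoubleNegation (i A B) (a , b) (right p) = allowed-noDoubleNegation B b p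
allowed-noDoubleNegation (n (i A B)) a (negand p) = allowed-noDoubleNegation (i A B) a p
allowed-noDoubleNegation (n (var x)) a (negand ())

variables : Formula → List ℕ
variables (var x) = x ∷ []
variables (i A B) = variables A ++ variables B
variables (n A) = variables A

nth : List ℕ → ℕ → ℕ
nth [] _ = 0
nth (x ∷ xs) zero = x
nth (x ∷ xs) (suc k) = nth xs k

index : List ℕ → ℕ → ℕ
index [] _ = 0
index (x ∷ xs) y with x ≟ y
... | yes _ = 0
... | no _ = suc (index xs y)

module Detachment (A B C : Formula) where

  mgu : Subst
  -- All unifiers factor through the result for any fuel; whether 100 sufficed to unify is settled
  -- by `A′ ≡ C′` in `Valid`.
  mgu = unifier 100 ((A [ evens ] , C [ odds ]) ∷ [])

  A′ B′ C′ : Formula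
  A′ = A [ evens ⨟ mgu ]
  B′ = B [ evens ⨟ mgu ]
  C′ = C [ odds ⨟ mgu ]

  -- With `B′` listed first, the variables of the conclusion are numbered from 0 in order of first
  -- occurrence.
  order : List ℕ
  order = deduplicate _≟_ (variables (i B′ A′))

  canonical original : Subst
  canonical = var ∘ index order
  original = var ∘ nth order

  conclusion : Formula
  conclusion = B [ evens ⨟ mgu ⨟ canonical ]

  -- Generality holds for every output of `unifier`. What remains to be tested is that it unifies,
  -- that the renumbering can be undone and that the conclusion is free of double negations.
  Valid : Set
  Valid = A′ ≡ C′ × i A′ B′ [ canonical ⨟ original ] ≡ i A′ B′ × NoDoubleNegation conclusion

  valid? : Dec Valid
  valid? = (A′ ≟ᶠ C′) ×-dec (i A′ B′ [ canonical ⨟ original ] ≟ᶠ i A′ B′) ×-dec noDoubleNegation? conclusion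

  valid-detach : Valid → T ⊢ i A B → T ⊢ C → T ⊢ conclusion
  valid-detach (unifies , invertible , free) ⊢AB ⊢C =
    condense (evens ⨟ mgu ⨟ canonical) (odds ⨟ mgu ⨟ canonical) ⊢AB ⊢C
      (trans (sym ([]-⨟ A)) (trans (cong (_[ canonical ]) unifies) ([]-⨟ C)))
      general (allowed-noDoubleNegation conclusion free)
    where
    original-C′ : C′ [ canonical ⨟ original ] ≡ C′
    original-C′ = subst (λ D → D [ canonical ⨟ original ] ≡ D) unifies (proj₁ (i-injective invertible))

    factor : ∀ D (ρ : ℕ → ℕ) τ → (∀ x → τ x ≡ (mgu ⨟ τ) x) →
      D [ (var ∘ ρ) ⨟ mgu ] [ canonical ⨟ original ] ≡ D [ (var ∘ ρ) ⨟ mgu ] →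
      AgreeOn D (τ ∘ ρ) (((var ∘ ρ) ⨟ mgu ⨟ canonical) ⨟ (original ⨟ τ))
    factor D ρ τ most eq {x} p = begin
      τ (ρ x) ≡⟨ most (ρ x) ⟩
      mgu (ρ x) [ τ ] ≡⟨ cong (_[ τ ]) ([]-cong⁻¹ D (trans (sym ([]-⨟ D)) eq) p) ⟨
      mgu (ρ x) [ canonical ⨟ original ] [ τ ] ≡⟨ cong (_[ τ ]) ([]-⨟ (mgu (ρ x))) ⟨
      mgu (ρ x) [ canonical ] [ original ] [ τ ] ≡⟨ []-⨟ (mgu (ρ x) [ canonical ]) ⟩
      mgu (ρ x) [ canonical ] [ original ⨟ τ ] ∎
      where open ≡-Reasoning

    general : ∀ τ₁ τ₂ → A [ τ₁ ] ≡ C [ τ₂ ] → ∃[ δ ] AgreeOn (i A B) τ₁ ((evens ⨟ mgu ⨟ canonical) ⨟ δ) × AgreeOn C τ₂ ((odds ⨟ mgu ⨟ canonical) ⨟ δ)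
    -- The factor undoes the renumbering and then applies `τ′`, which absorbs `mgu`.
    general τ₁ τ₂ eq = original ⨟ τ′ ,
      (λ {x} p → trans (sym (interleave-even τ₁ τ₂ x)) (factor (i A B) even τ′ most invertible p)) ,
      (λ {x} p → trans (sym (interleave-odd τ₁ τ₂ x)) (factor C odd τ′ most original-C′ p))
      where
      τ′ = interleave τ₁ τ₂

      on-evens : A [ evens ] [ τ′ ] ≡ A [ τ₁ ]
      on-evens = trans ([]-⨟ A) ([]-cong A λ {x} _ → interleave-even τ₁ τ₂ x)

      on-odds : C [ odds ] [ τ′ ] ≡ C [ τ₂ ]
      on-odds = trans ([]-⨟ C) ([]-cong C λ {x} _ → interleave-odd τ₁ τ₂ x)

      most : ∀ x → τ′ x ≡ (mgu ⨟ τ′) x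
      most = unifier-general 100 ((A [ evens ] , C [ odds ]) ∷ []) (trans on-evens (trans eq (sym on-odds)) ∷ [])

infixl 6 _∙_

data Term : Set where
  ℓ₁ ℓ₂ ℓ₃ : Term
  _∙_ : Term → Term → Term

detachment : Maybe Formula → Maybe Formula → Maybe Formula
detachment (just (i A B)) (just C) with Detachment.valid? A B C
... | yes _ = just (Detachment.conclusion A B C)
... | no _ = nothing
detachment _ _ = nothing

value : Term → Maybe Formula
value ℓ₁ = just L1
value ℓ₂ = just L2
value ℓ₃ = just L3
value (d ∙ e) = detachment (value d) (value e)

-- With `refl` for the equation, the type checker runs the unifications of the term and compares the
-- outcome with the stated formula.
derive : ∀ d → value d ≡ just A → T ⊢ A
derive ℓ₁ refl = axiom (here ~-refl)
derive ℓ₂ refl = axiom (there (here ~-refl))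
derive ℓ₃ refl = axiom (there (there (here ~-refl)))
derive (d ∙ e) eq with value d in eqd | value e in eqe
... | just (i A B) | just C with Detachment.valid? A B C
derive (d ∙ e) refl | just (i A B) | just C | yes v = Detachment.valid-detach A B C v (derive d eqd) (derive e eqe)

-- Combinators and propositional theorems.

infixl 5 _»_

_»_ : Term → Term → Term
d » e = ℓ₁ ∙ d ∙ e

-- In Łukasiewicz's notation these have the values CCpCqrCCsqCpCsr,
-- CCpqCCCprsCCqrs, CCCNpqrCpr and CCNpqCCqpp.
t₁ t₂ t₃ t₄ : Term
t₁ = ℓ₁ ∙ ℓ₁ ∙ (ℓ₁ ∙ ℓ₁)
t₂ = ℓ₁ ∙ ℓ₁ ∙ ℓ₁
t₃ = ℓ₁ ∙ ℓ₃
t₄ = t₁ ∙ t₂ ∙ (t₃ ∙ (t₃ ∙ t₂ ∙ ℓ₂ ∙ ℓ₂)) » ℓ₂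

-- The value of a term built from combinators is its principal type.
-- Apart from the usual ones, 𝐄 f g x y = f x (g y).
𝐈 𝐊 𝐂 𝐁 𝐖 𝐄 : Term
𝐈 = t₃ ∙ ℓ₂
𝐊 = t₁ ∙ (t₃ ∙ t₄) ∙ ℓ₃
𝐂 = t₁ ∙ (𝐊 » t₄)
𝐁 = 𝐂 ∙ ℓ₁

-- `explosion` is `i (n p) (i p q)`. It turns `i (i p q) p` into `i (n p) p`, whence L2 gives `p`:
-- this is Peirce's law.
explosion peirce : Term
explosion = 𝐂 ∙ ℓ₃
peirce = ℓ₁ ∙ explosion » ℓ₂
𝐖 = ℓ₁ » peirce
𝐄 = 𝐁 ∙ 𝐁 » 𝐂

-- Peirce's law gives `i (i (i p q) r) (i (i r p) p)`. L2 matches the antecedent with `n r` for `p`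
-- and `r` for `q`, which leaves `i (i r (n r)) (n r)` as `reductio`.
reductio contraposition : Term
reductio = (ℓ₁ » 𝐁 ∙ peirce) ∙ ℓ₂
contraposition = 𝐂 ∙ (𝐁 ∙ 𝐁 ∙ explosion) » 𝐁 ∙ reductio

-- Substitution instances

weakening : T ⊢ i (var 0) (i (var 1) (var 0))
weakening = derive 𝐊 refl

iteration : T ⊢ i (i (var 0) (var 0)) (i (var 0) (var 0))
iteration = derive (𝐖 ∙ (𝐄 ∙ 𝐁 ∙ 𝐈)) refl

-- λ f g x. 𝐊 x (f (g x))
new-variable : T ⊢ i (i (var 0) (var 1)) (i (i (var 2) (var 0)) (i (var 2) (var 2)))
new-variable = derive (𝐁 ∙ (𝐁 ∙ (𝐄 ∙ 𝐊)) ∙ 𝐁 » 𝐁 ∙ 𝐖) refl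

-- λ f g x. 𝐊 x (λ y. f (g y) x)
old-variable : T ⊢ i (i (var 0) (i (var 1) (var 2))) (i (i (var 3) (var 0)) (i (var 1) (var 1)))
old-variable = derive (𝐁 ∙ (𝐁 ∙ (𝐄 ∙ 𝐊)) ∙ (𝐁 » 𝐁 ∙ 𝐂) » 𝐁 ∙ 𝐖) refl

negate : T ⊢ i (i (var 0) (i (var 1) (var 2))) (i (var 0) (i (n (var 2)) (n (var 1))))
negate = derive (𝐁 ∙ contraposition) refl

-- λ f g p h x. g p (h (f p x))
imply : T ⊢ i (i (var 0) (i (var 1) (var 2))) (i (i (var 0) (i (var 3) (var 4))) (i (var 0) (i (i (var 2) (var 3)) (i (var 1) (var 4)))))
imply = derive (𝐁 ∙ (𝐂 ∙ (𝐁 ∙ 𝐄 ∙ (𝐁 ∙ (𝐁 ∙ 𝐁) ∙ (𝐁 ∙ 𝐁)))) ∙ (𝐁 ∙ ℓ₁) » 𝐁 ∙ 𝐖) refl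

infixr 5 _,,_

_,,_ : Formula → Subst → Subst
(A ,, σ) zero = A
(A ,, σ) (suc x) = σ x

occurring : ∀ m A {_ : True (allUpTo? (λ x → var x ⊑? A) m)} → ∀ {x} → x < m → var x ⊑ A
occurring m A {t} = toWitness t

-- Premisses of detachment are renamed apart, so i (i A B) (i A B) cannot be had
-- from i A A and i B B when A and B share variables.  From i X (i A A) and
-- i X (i B B) the analogue can be had: unifying the two copies of X identifies
-- the variables again.
context : ℕ → Formula
context zero = i (var 0) (var 0)
context (suc k) = i (var (suc k)) (context k)

context-below : ∀ k → VarsBelow (suc k) (context k)
context-below zero (left here) = s≤s z≤n
context-below zero (right here) = s≤s z≤n
context-below (suc k) (left here) = ≤-refl
context-below (suc k) (right p) = m<n⇒m<1+n (context-below k p)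

context-occurs : ∀ k {x} → x < suc k → var x ⊑ context k
context-occurs zero {zero} _ = left here
context-occurs zero {suc x} (s≤s ())
context-occurs (suc k) x< with m<1+n⇒m<n∨m≡n x<
... | inj₁ x<k = right (context-occurs k x<k)
... | inj₂ refl = left here

context-allowed : ∀ k → Allowed T (context k)
context-allowed zero = allowed-i allowed-var allowed-var
context-allowed (suc k) = allowed-i allowed-var (context-allowed k)

context-theorem : ∀ k → T ⊢ context k
context-theorem zero = derive 𝐈 refl
-- `var 1` of `weakening` is the first variable from `m = 1` on, so it becomes `var (suc k)`, the
-- variable that `context (suc k)` adds. `identity-var` uses the same device.
context-theorem (suc k) = match-major 1 (suc k) (const (context k)) weakening (occurring 1 (var 0))
  (context-theorem k) (context-below k) (context-allowed (suc k))

identity-below : ∀ k → VarsBelow (suc k) A → VarsBelow (suc k) (i (context k) (i A A))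
identity-below k below (left p) = context-below k p
identity-below k below (right (left p)) = below p
identity-below k below (right (right p)) = below p

identity-var : ∀ k {j} → j < suc k → T ⊢ i (context k) (i (var j) (var j))
identity-var zero {zero} _ = iteration
identity-var zero {suc j} (s≤s ())
identity-var (suc k) {j} j< with m<1+n⇒m<n∨m≡n j<
... | inj₁ j<k = match-major 3 (suc k) (context k ,, const (var j)) old-variable
  (occurring 3 (i (var 0) (i (var 1) (var 2))))
  (identity-var k j<k) (identity-below k λ { here → j<k })
  (allowed-i (context-allowed (suc k)) (allowed-i allowed-var allowed-var))
-- Some available consequence of `context k` has to serve as minor premiss; `var 0` occurs in every
-- context.
... | inj₂ refl = match-major 2 (suc k) (context k ,, const (i (var 0) (var 0))) new-variable
  (occurring 2 (i (var 0) (var 1)))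
  (identity-var k (s≤s z≤n)) (identity-below k λ { here → s≤s z≤n })
  (allowed-i (context-allowed (suc k)) (allowed-i allowed-var allowed-var))

identity-in-context : ∀ k A → VarsBelow (suc k) A → Allowed T A → T ⊢ i (context k) (i A A)
identity-in-context k (var x) below ok = identity-var k (below here)
identity-in-context k (n A) below ok =
  match-major 3 (suc k) (context k ,, const A) negate (occurring 3 (i (var 0) (i (var 1) (var 2))))
    (identity-in-context k A (below ∘ negand) (ok ∘ negand)) (identity-below k (below ∘ negand))
    (allowed-i (context-allowed k) (allowed-i ok ok))
identity-in-context {T} k (i A B) below ok =
  subst (T ⊢_) conclusion
    (match-major m K (splice K var (const B)) half occurs
      (subst (T ⊢_) (sym antecedent) (identity-in-context k B (below ∘ right) (ok ∘ right)))
      (subst (VarsBelow K) (sym antecedent) (identity-below k (below ∘ right)))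
      (subst (Allowed T) (sym conclusion) (allowed-i (context-allowed k) (allowed-i ok ok))))
  where
  K = suc k
  m = 2 + K

  -- The variables of `A` also occur in `context k`. Detaching `i (context k) (i B B)` therefore
  -- keeps them fixed and sends the two fresh variables to `B`.
  half : T ⊢ i (i (context k) (i (var K) (var (suc K)))) (i (context k) (i (i A (var K)) (i A (var (suc K)))))
  half = match-major 3 K (context k ,, const A) imply (occurring 3 (i (var 0) (i (var 1) (var 2))))
    (identity-in-context k A (below ∘ left) (ok ∘ left)) (identity-below k (below ∘ left))
    (allowed-i (allowed-i (context-allowed k) (allowed-i allowed-var allowed-var))
      (allowed-i (context-allowed k)
        (allowed-i (allowed-i (ok ∘ left) allowed-var) (allowed-i (ok ∘ left) allowed-var))))

  occurs : ∀ {x} → x < m → var x ⊑ i (context k) (i (var K) (var (suc K)))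
  occurs x<m with m<1+n⇒m<n∨m≡n x<m
  ... | inj₂ refl = right (right here)
  ... | inj₁ x<1+K with m<1+n⇒m<n∨m≡n x<1+K
  ...   | inj₂ refl = right (left here)
  ...   | inj₁ x<K = left (context-occurs k x<K)

  θ = splice m (splice K var (const B)) (λ y → var (y + K))

  fixes : ∀ D → VarsBelow K D → D [ θ ] ≡ D
  fixes D D<K = []-fix D λ p → trans (splice-below {k = m} (m≤n⇒m≤o+n 2 (D<K p))) (splice-below {k = K} (D<K p))

  θ-new : ∀ y → y < 2 → θ (y + K) ≡ B
  θ-new y y<2 = trans (splice-below {k = m} (+-monoˡ-< K y<2)) (splice-from K y)

  antecedent : i (context k) (i (var K) (var (suc K))) [ θ ] ≡ i (context k) (i B B)
  antecedent = cong₂ i (fixes (context k) (context-below k)) (cong₂ i (θ-new 0 (s≤s z≤n)) (θ-new 1 (s≤s (s≤s z≤n))))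

  conclusion : i (context k) (i (i A (var K)) (i A (var (suc K)))) [ θ ] ≡ i (context k) (i (i A B) (i A B))
  conclusion = cong₂ i (fixes (context k) (context-below k))
    (cong₂ i (cong₂ i (fixes A (below ∘ left)) (θ-new 0 (s≤s z≤n))) (cong₂ i (fixes A (below ∘ left)) (θ-new 1 (s≤s (s≤s z≤n)))))

-- The context is itself a theorem, so it can be detached once the formula is complete.
identity : ∀ A → Allowed T A → T ⊢ i A A
identity A ok = modus-ponens
  (identity-in-context (bound A) A (m<n⇒m<1+n ∘ vars-below-bound A) ok)
  (context-theorem (bound A)) (allowed-i ok ok)

substitution-instance : ∀ τ → T ⊢ C → Allowed T (C [ τ ]) → T ⊢ C [ τ ]
substitution-instance {C = C} τ ⊢C ok = match-minor τ (identity (C [ τ ]) ok) ⊢C ok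

-- Erasing double negations

erase : List Formula → Formula → Formula
erase S (var x) = var x
erase S (i A B) = i (erase S A) (erase S B)
erase S (n (n A)) = if does (any? (n (n A) ≟ᶠ_) S) then erase S A else n (erase S (n A))
erase S (n A) = n (erase S A)

Erase-erase : ∀ {S} → Erase S A B → erase S A ≡ B
Erase-erase var = refl
Erase-erase (i p q) = cong₂ i (Erase-erase p) (Erase-erase q)
Erase-erase (keep {A = var x} _ p) = cong n (Erase-erase p)
Erase-erase (keep {A = i A B} _ p) = cong n (Erase-erase p)
Erase-erase {S = S} (keep {A = n A} ∉S p) with any? (n (n A) ≟ᶠ_) S
... | yes ∈S = contradiction ∈S ∉S
... | no _ = cong n (Erase-erase p)
Erase-erase {S = S} (drop {q} ∈S p) with any? (n (n q) ≟ᶠ_) S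
... | yes _ = Erase-erase p
... | no ∉S = contradiction ∈S ∉S

-- When `n (n A)` is dropped, the claim for `n A` is the claim for `A` with its alternatives
-- exchanged.
erase-n : ∀ S A → erase S (n A) ≡ n (erase S A) ⊎ erase S A ≡ n (erase S (n A))
erase-n S (var x) = inj₁ refl
erase-n S (i A B) = inj₁ refl
erase-n S (n A) with any? (n (n A) ≟ᶠ_) S
... | no _ = inj₁ refl
... | yes _ with erase-n S A
...   | inj₁ eq = inj₂ eq
...   | inj₂ eq = inj₁ eq

-- Normal forms relative to a target formula.

normal-n : Formula → Formula → Formula
normal-n T (n A) with n (n A) ⊑? T
... | yes _ = n (n A)
... | no _ = A
normal-n T A = n A

normal : Formula → Formula → Formula
normal T (var x) = var x
normal T (i A B) = i (normal T A) (normal T B)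
normal T (n A) = normal-n T (normal T A)

normal-n-allowed : ∀ A → Allowed T A → Allowed T (normal-n T A)
normal-n-allowed (var x) ok (negand p) = ok p
normal-n-allowed (i A B) ok (negand p) = ok p
normal-n-allowed {T} (n A) ok p with n (n A) ⊑? T
... | no _ = ok (negand p)
normal-n-allowed (n A) ok here | yes nnA⊑T = nnA⊑T
normal-n-allowed (n A) ok (negand p) | yes _ = ok p

-- Negation is reapplied to a formula already normal, so a new double negation can arise only at the
-- root, and it stays only if it occurs in `T`.
normal-allowed : ∀ A → Allowed T (normal T A)
normal-allowed (var x) ()
normal-allowed (i A B) = allowed-i (normal-allowed A) (normal-allowed B)
normal-allowed (n A) = normal-n-allowed _ (normal-allowed A)

normal-fix : ∀ A → A ⊑ T → normal T A ≡ A
normal-fix (var x) p = refl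
normal-fix (i A B) p = cong₂ i (normal-fix A (⊑-trans (left here) p)) (normal-fix B (⊑-trans (right here) p))
normal-fix {T} (n A) p rewrite normal-fix A (⊑-trans (negand here) p) = fix A p
  where
  fix : ∀ A → n A ⊑ T → normal-n T A ≡ n A
  fix (var x) p = refl
  fix (i A B) p = refl
  fix (n A) p with n (n A) ⊑? T
  ... | yes _ = refl
  ... | no ¬p = contradiction p ¬p

normal-n-n : ∀ A → normal-n T A ≡ n A ⊎ A ≡ n (normal-n T A)
normal-n-n (var x) = inj₁ refl
normal-n-n (i A B) = inj₁ refl
normal-n-n {T} (n A) with n (n A) ⊑? T
... | yes _ = inj₁ refl
... | no _ = inj₂ refl

-- Reducts of axioms and of proofs.

reduce : List Formula → Formula → Formula → Formula
reduce S T A = normal T (erase S A)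

reduce-n : ∀ S T A → reduce S T (n A) ≡ n (reduce S T A) ⊎ reduce S T A ≡ n (reduce S T (n A))
reduce-n S T A with erase-n S A
... | inj₁ eq rewrite eq = normal-n-n (normal T (erase S A))
... | inj₂ eq rewrite eq with normal-n-n {T} (normal T (erase S (n A)))
...   | inj₁ eq′ = inj₂ eq′
...   | inj₂ eq′ = inj₁ eq′

-- `A` and `B` stand for the reducts of a formula and of its negation. If the negation cancelled,
-- the instance of L2 has become one of `reductio`.
L2-reduct : ∀ A B → B ≡ n A ⊎ A ≡ n B → Allowed T (i (i B A) A) → T ⊢ i (i B A) A
L2-reduct A B (inj₁ refl) = substitution-instance (const A) (derive ℓ₂ refl)
L2-reduct A B (inj₂ refl) = substitution-instance (const B) (derive reductio refl)

L3-reduct : ∀ A B C → B ≡ n A ⊎ A ≡ n B → Allowed T (i A (i B C)) → T ⊢ i A (i B C)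
L3-reduct A B C (inj₁ refl) = substitution-instance (A ,, const C) (derive ℓ₃ refl)
L3-reduct A B C (inj₂ refl) = substitution-instance (B ,, const C) (derive explosion refl)

axiom-reduct : ∀ S T τ → IsAxiom Łukasiewicz A → T ⊢ reduce S T (A [ τ ])
axiom-reduct S T τ (here (ρ , _ , refl)) =
  substitution-instance (λ x → reduce S T (τ (ρ x))) (derive ℓ₁ refl) (normal-allowed (erase S (L1 [ var ∘ ρ ] [ τ ])))
axiom-reduct S T τ (there (here (ρ , _ , refl))) =
  L2-reduct _ _ (reduce-n S T (τ (ρ 0))) (normal-allowed (erase S (L2 [ var ∘ ρ ] [ τ ])))
axiom-reduct S T τ (there (there (here (ρ , _ , refl)))) =
  L3-reduct _ _ _ (reduce-n S T (τ (ρ 0))) (normal-allowed (erase S (L3 [ var ∘ ρ ] [ τ ])))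

module _ (S : List Formula) (T : Formula) where

  -- All instances are included, because a detachment uses its premisses at the instances prescribed
  -- by its unifier.
  Reducible : Formula → Set
  Reducible D = ∀ τ → T ⊢ reduce S T (D [ τ ])

  detachment-reducible : CondensedDetachment M N A → Reducible M → Reducible N → Reducible A
  detachment-reducible {M} {N} record { B = B ; majorVariant = ρ₁ , _ , M≡ ; minorVariant = ρ₂ , _ , N≡ ; σ = θ ; mgu = mgu ; result = ρ , _ , refl } redM redN τ =
    -- Both premisses are instantiated along the unifier, the renaming of the conclusion and `τ`;
    -- there the minor is the antecedent of the major, and `reduce` preserves this.
    modus-ponens
      (subst ⊢reduct (trans (instance-of M) (cong pull M≡)) (redM (pull ∘ var ∘ ρ₁)))
      (subst ⊢reduct (trans (instance-of N) (trans (cong pull N≡) (cong (λ D → D [ var ∘ ρ ] [ τ ]) (sym (IsMGU.unifies mgu))))) (redN (pull ∘ var ∘ ρ₂)))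
      (normal-allowed (erase S (pull B)))
    where
    ⊢reduct : Formula → Set
    ⊢reduct D = T ⊢ reduce S T D

    pull : Formula → Formula
    pull D = D [ θ ] [ var ∘ ρ ] [ τ ]

    instance-of : ∀ D {ρ′ : ℕ → ℕ} → D [ pull ∘ var ∘ ρ′ ] ≡ pull (D [ var ∘ ρ′ ])
    instance-of (var x) = refl
    instance-of (i A B) = cong₂ i (instance-of A) (instance-of B)
    instance-of (n A) = cong n (instance-of A)

  proof-reducible : ∀ {Γ} → IsProof Łukasiewicz Γ → All Reducible Γ
  proof-reducible empty = []
  proof-reducible (axiom p a) = (λ τ → axiom-reduct S T τ a) ∷ proof-reducible p
  proof-reducible (detach p M∈ N∈ cd) = detachment-reducible cd (lookup reds M∈) (lookup reds N∈) ∷ reds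
    where reds = proof-reducible p

theorem5 : AdmitsStrongDoubleNegationElimination Łukasiewicz
theorem5 B B* (Γ , proof) (S , _ , B↝B*) with linearise ⊢B*
  where
  -- Erasure turns `B` into `B*`, and `B*` is its own normal form when it is also the target.
  reduces : reduce S B* (B [ var ]) ≡ B*
  reduces = trans (cong (reduce S B*) ([]-var B)) (trans (cong (normal B*) (Erase-erase B↝B*)) (normal-fix B* here))

  ⊢B* : B* ⊢ B*
  ⊢B* = subst (B* ⊢_) reduces (lookup (proof-reducible S B* proof) (here refl) var)
... | Δ , proof* , lines = Δ , proof* , double-negations
  where
  double-negations : ∀ D t → DeducedStep Łukasiewicz (B* ∷ Δ) D → n (n t) ⊑ D → ∃[ s ] s ⊑ B* × s ~ n (n t)
  double-negations D t (D∈ , ¬axiom) p with lookup lines D∈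
  ... | inj₁ a = contradiction a ¬axiom
  ... | inj₂ ok = n (n t) , ok p , ~-refl
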